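{- There is no elusive pair with parameters $(4,3,3)$; that is, there do not exist a code $C$ in the Hamming graph $\Gamma=H(4,3)$ with minimum distance $3$ and a subgroup $X\leq\mathrm{Aut}(\Gamma)$ such that $X$ fixes $\Gamma_1(C)$ setwise but does not fix $C$ setwise.
   Context: Hamming graph: for a finite set $Q$ of size $q$, $\Gamma=H(m,q)$ is the graph whose vertices are all $m$-tuples with entries in $Q$, two $m$-tuples being adjacent if and only if they differ in exactly one position. $\mathrm{Aut}(\Gamma)$ is its automorphism group. The distance $d(\alpha,\beta)$ between vertices is the number of entries in which they differ. A code is a subset $C$ of the vertex set of $\Gamma$; its minimum distance is $\delta=\min\{d(\alpha,\beta)\mid \alpha,\beta\in C,\ \alpha\neq\beta\}$. The set of neighbours of $C$, denoted $\Gamma_1(C)$, is the set of all vertices of $\Gamma$ that are not in $C$ but are adjacent to at least one element of $C$. Elusive pair: let $C$ be a code in $\Gamma=H(m,q)$ with minimum distance $\delta$ and let $X\leq\mathrm{Aut}(\Gamma)$ be such that $X$ fixes $\Gamma_1(C)$ setwise but does not fix $C$ setwise. Then $(C,X)$ is called an elusive pair with parameters $(m,q,\delta)$. -}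

module Defs where

open import Algebra.Bundles using (Group)
open import Data.Fin.Base using (Fin)
open import Data.Fin.Properties using (_≟_)
open import Data.Nat.Base using (ℕ; suc; _≤_)
open import Data.Product.Base using (_×_; _,_; uncurry; ∃-syntax)
open import Data.Vec.Base using (Vec; []; _∷_; zip; count)
open import Function.Base using (_∘_)
open import Function.Bundles using (_↔_; _⇔_; mk⇔; Inverse; Equivalence)
open import Function.Properties.Inverse using (↔-refl; ↔-sym; ↔-trans)
open import Function.Properties.Equivalence using () renaming (refl to ⇔-refl; trans to ⇔-trans)
open import Level using (Level; 0ℓ; _⊔_) renaming (suc to lsuc)
open import Relation.Binary.Core using (Rel)
open import Relation.Binary.Definitions using (Symmetric; Irreflexive; _Respects_)
open import Relation.Binary.PropositionalEquality
  using (_≡_; _≢_; refl; sym; trans; cong; subst₂)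
open import Relation.Nullary.Decidable using (yes; no; ¬?)
open import Relation.Nullary.Negation using (¬_; contradiction)
open import Relation.Unary using (Pred; _∈_; _∉_; _≐_)

record Subgroup {a ℓ} (G : Group a ℓ) (s : Level) : Set (a ⊔ ℓ ⊔ lsuc s) where
  open Group G
  field
    Member    : Pred Carrier s
    resp-≈    : Member Respects _≈_
    ε-closed  : ε ∈ Member
    ∙-closed  : ∀ {g h} → g ∈ Member → h ∈ Member → (g ∙ h) ∈ Member
    ⁻¹-closed : ∀ {g} → g ∈ Member → (g ⁻¹) ∈ Member

record Graph : Set₁ where
  field
    Vertex      : Set
    Adjacent    : Rel Vertex 0ℓ
    adj-sym     : Symmetric Adjacent
    adj-irrefl  : Irreflexive _≡_ Adjacent

module _ (Γ : Graph) where
  open Graph Γ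

  record Automorphism : Set where
    field
      bijection : Vertex ↔ Vertex

    open Inverse bijection public using (to; from; strictlyInverseˡ; strictlyInverseʳ)

    field
      preserves : ∀ α β → Adjacent α β ⇔ Adjacent (to α) (to β)

  open Automorphism

  -- Automorphisms are compared pointwise, since functions are not extensional;
  -- g ∙ h applies h first.
  Aut : Group 0ℓ 0ℓ
  Aut = record
    { Carrier = Automorphism
    ; _≈_     = λ g h → ∀ α → to g α ≡ to h α
    ; _∙_     = λ g h → record
      { bijection = ↔-trans (bijection h) (bijection g)
      ; preserves = λ α β → ⇔-trans (preserves h α β) (preserves g (to h α) (to h β))
      }
    ; ε       = record { bijection = ↔-refl ; preserves = λ _ _ → ⇔-refl }
    ; _⁻¹     = inv
    ; isGroup = record
      { isMonoid = record
        { isSemigroup = record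
          { isMagma = record
            { isEquivalence = record
              { refl  = λ _ → refl
              ; sym   = λ p α → sym (p α)
              ; trans = λ p q α → trans (p α) (q α)
              }
            ; ∙-cong = λ {_} {g′} {h} p q α → trans (p (to h α)) (cong (to g′) (q α))
            }
          ; assoc = λ _ _ _ _ → refl
          }
        ; identity = (λ _ _ → refl) , (λ _ _ → refl)
        }
      ; inverse = strictlyInverseʳ , strictlyInverseˡ
      ; ⁻¹-cong = λ {g} {h} p α →
          trans (cong (from g) (sym (trans (p (from h α)) (strictlyInverseˡ h α))))
                (strictlyInverseʳ g (from h α))
      }
    }
    where
    inv : Automorphism → Automorphism
    inv g = record
      { bijection = ↔-sym (bijection g)
      ; preserves = λ α β → mk⇔
          (λ e → Equivalence.from (preserves g (from g α) (from g β))
                   (subst₂ Adjacent (sym (strictlyInverseˡ g α)) (sym (strictlyInverseˡ g β)) e))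
          (λ e → subst₂ Adjacent (strictlyInverseˡ g α) (strictlyInverseˡ g β)
                   (Equivalence.to (preserves g (from g α) (from g β)) e))
      }

module _ {Γ : Graph} where
  open Graph Γ

  Γ₁ : ∀ {c} → Pred Vertex c → Pred Vertex c
  Γ₁ C β = β ∉ C × ∃[ α ] (α ∈ C × Adjacent α β)

  image : ∀ {s} → Automorphism Γ → Pred Vertex s → Pred Vertex s
  image g S β = ∃[ α ] (α ∈ S × Automorphism.to g α ≡ β)

  FixesSetwise : ∀ {x s} → Subgroup (Aut Γ) x → Pred Vertex s → Set (x ⊔ s)
  FixesSetwise X S = ∀ g → g ∈ Subgroup.Member X → image g S ≐ S

d : ∀ {m q} → Vec (Fin q) m → Vec (Fin q) m → ℕ
d α β = count (¬? ∘ uncurry _≟_) (zip α β)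

d-refl : ∀ {m q} (α : Vec (Fin q) m) → d α α ≡ 0
d-refl []      = refl
d-refl (x ∷ α) with x ≟ x
... | yes _  = d-refl α
... | no x≢x = contradiction refl x≢x

d-sym : ∀ {m q} (α β : Vec (Fin q) m) → d α β ≡ d β α
d-sym []      []      = refl
d-sym (x ∷ α) (y ∷ β) with x ≟ y | y ≟ x
... | yes _   | yes _   = d-sym α β
... | no _    | no _    = cong suc (d-sym α β)
... | yes x≡y | no y≢x  = contradiction (sym x≡y) y≢x
... | no x≢y  | yes y≡x = contradiction (sym y≡x) x≢y

H : ℕ → ℕ → Graph
H m q = record
  { Vertex     = Vec (Fin q) m
  ; Adjacent   = λ α β → d α β ≡ 1
  ; adj-sym    = λ {α} {β} p → trans (d-sym β α) p
  ; adj-irrefl = λ { {α} refl p → contradiction (trans (sym (d-refl α)) p) λ () }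
  }

-- Codes are arbitrary, not necessarily decidable, subsets of the vertex set.
Code : ℕ → ℕ → (c : Level) → Set (lsuc c)
Code m q c = Pred (Graph.Vertex (H m q)) c

-- A code with fewer than two codewords has no minimum distance.
record MinimumDistance {m q c} (C : Code m q c) (δ : ℕ) : Set c where
  field
    attained   : ∃[ α ] ∃[ β ] (α ∈ C × β ∈ C × α ≢ β × d α β ≡ δ)
    lowerBound : ∀ {α β} → α ∈ C → β ∈ C → α ≢ β → δ ≤ d α β

record ElusivePair (m q δ : ℕ) {c x} (C : Code m q c) (X : Subgroup (Aut (H m q)) x)
       : Set (c ⊔ x) where
  field
    minimumDistance   : MinimumDistance C δ
    fixes-neighbours  : FixesSetwise X (Γ₁ {H m q} C)
    does-not-fix-code : ¬ FixesSetwise X C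

{-# OPTIONS --safe #-}

-- Let g ∈ X.  The codes C and gC both have pairwise distances at least 3 and
-- the same neighbours.  Let v lie in just one of them.  Then any neighbour u of
-- v is a neighbour of the other code, hence adjacent to some word w of it, and
-- w does not lie in the first code, because d(v, w) ≤ 2.  So words in exactly
-- one of the codes force further such words, alternating between the codes,
-- while words of one code stay at distance at least 3 and words of opposite
-- codes at distance at least 2.  In H(4,3) an exhaustive search starting from
-- the single word 0000 shows that this cannot go on; a coordinatewise
-- permutation moves any word to 0000.

module Submission where

open import Defs
open import Algebra.Bundles using (Group)
open import Data.Bool.Base using (Bool; true; false; not; if_then_else_; T)
open import Data.Bool.ListAction using (all)
import Data.Bool.Properties as Bool
open import Data.Fin.Base using (Fin; zero)
import Data.Fin.Properties as Fin
open import Data.Fin.Permutation.Components using (transpose; transpose-inverse)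
open import Data.List.Base
  using (List; []; _∷_; [_]; _++_; map; filter; allFin; cartesianProductWith)
open import Data.List.Membership.Propositional using () renaming (_∈_ to _∈ₗ_)
open import Data.List.Membership.Propositional.Properties
  using (∈-filter⁺; ∈-filter⁻; ∈-cartesianProductWith⁺; ∈-allFin)
open import Data.List.Relation.Unary.All as All using (All; []; _∷_; all?)
import Data.List.Relation.Unary.All.Properties as All
open import Data.List.Relation.Unary.Any using (any?; here)
open import Data.Nat.Base using (ℕ; zero; suc; _+_; _≤_; z≤n; s≤s)
import Data.Nat.Properties as ℕ
open import Data.Product.Base using (_×_; _,_; proj₁; proj₂; map₂; ∃-syntax; ∃₂)
open import Data.Sum.Base using (_⊎_; inj₁; inj₂)
open import Data.Vec.Base using (Vec; []; _∷_; replicate; zipWith)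
open import Data.Vec.Properties using (≡-dec)
open import Function.Base using (_∘_)
open import Function.Bundles using (Equivalence)
open import Relation.Binary.PropositionalEquality
  using (_≡_; _≢_; refl; sym; trans; cong; cong₂; subst)
open import Relation.Nullary.Decidable
  using (Dec; yes; no; does; _×-dec_; _⊎-dec_; ¬¬-excluded-middle)
open import Relation.Nullary.Negation using (¬_; contradiction; ¬¬-Monad)
open import Relation.Unary using (Pred; _∈_; _∉_; _⊆_)

private
  variable
    m q : ℕ

-- Hamming distance on words.

Word : ℕ → ℕ → Set
Word m q = Vec (Fin q) m

d≡0⇒≡ : ∀ (v w : Word m q) → d v w ≡ 0 → v ≡ w
d≡0⇒≡ []      []      _ = refl
d≡0⇒≡ (x ∷ v) (y ∷ w) p with x Fin.≟ y
... | yes refl = cong (x ∷_) (d≡0⇒≡ v w p)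

d-triangle : ∀ (u v w : Word m q) → d u w ≤ d u v + d v w
d-triangle []      []      []      = z≤n
d-triangle (x ∷ u) (y ∷ v) (z ∷ w) with x Fin.≟ z | x Fin.≟ y | y Fin.≟ z
... | yes _   | yes _   | yes _   = d-triangle u v w
... | yes _   | yes _   | no _    =
  ℕ.≤-trans (d-triangle u v w) (ℕ.+-monoʳ-≤ (d u v) (ℕ.n≤1+n _))
... | yes _   | no _    | yes _   = ℕ.m≤n⇒m≤1+n (d-triangle u v w)
... | yes _   | no _    | no _    =
  ℕ.m≤n⇒m≤1+n (ℕ.≤-trans (d-triangle u v w) (ℕ.+-monoʳ-≤ (d u v) (ℕ.n≤1+n _)))
... | no x≢z  | yes x≡y | yes y≡z = contradiction (trans x≡y y≡z) x≢z
... | no _    | yes _   | no _    =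
  subst (suc (d u w) ≤_) (sym (ℕ.+-suc (d u v) (d v w))) (s≤s (d-triangle u v w))
... | no _    | no _    | yes _   = s≤s (d-triangle u v w)
... | no _    | no _    | no _    =
  s≤s (ℕ.≤-trans (d-triangle u v w) (ℕ.+-monoʳ-≤ (d u v) (ℕ.n≤1+n _)))

d-∷-≡ : ∀ x (v w : Word m q) → d (x ∷ v) (x ∷ w) ≡ d v w
d-∷-≡ x v w with x Fin.≟ x
... | yes _  = refl
... | no x≢x = contradiction refl x≢x

d-∷-≢ : ∀ {x y} → x ≢ y → (v w : Word m q) → d (x ∷ v) (y ∷ w) ≡ suc (d v w)
d-∷-≢ {x = x} {y} x≢y v w with x Fin.≟ y
... | yes x≡y = contradiction x≡y x≢y
... | no _    = refl

-- The first coordinate in which `v` and `w` differ is overwritten by its value in `w`.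
d≡suc⇒step : ∀ {n} (v w : Word m q) → d v w ≡ suc n → ∃[ u ] (d v u ≡ 1 × d u w ≡ n)
d≡suc⇒step []      []      ()
d≡suc⇒step (x ∷ v) (y ∷ w) p with x Fin.≟ y
... | yes refl =
  let u , vu , uw = d≡suc⇒step v w p
  in x ∷ u , trans (d-∷-≡ x v u) vu , trans (d-∷-≡ x u w) uw
... | no x≢y =
  y ∷ v , trans (d-∷-≢ x≢y v v) (cong suc (d-refl v)) ,
  trans (d-∷-≡ y v w) (ℕ.suc-injective p)

-- The exhaustive search over labelled words.

words : ∀ m q → List (Word m q)
words zero    q = [ [] ]
words (suc m) q = cartesianProductWith _∷_ (allFin q) (words m q)

∈-words : (v : Word m q) → v ∈ₗ words m q
∈-words []      = here refl
∈-words (x ∷ v) = ∈-cartesianProductWith⁺ _∷_ (∈-allFin x) (∈-words v)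

neighbours : Word m q → List (Word m q)
neighbours v = filter (λ w → d v w ℕ.≟ 1) (words _ _)

-- The label of a word says to which of two given codes it belongs.
Labelled : ℕ → ℕ → Set
Labelled m q = Bool × Word m q

separation : Bool → Bool → ℕ
separation b c = if does (b Bool.≟ c) then 3 else 2

-- The first alternative lets both sides be the same labelled word.
Compatible : Labelled m q → Labelled m q → Set
Compatible (b , v) (c , w) = (b ≡ c × d v w ≡ 0) ⊎ separation b c ≤ d v w

compatible? : (x y : Labelled m q) → Dec (Compatible x y)
compatible? (b , v) (c , w) =
  (b Bool.≟ c ×-dec d v w ℕ.≟ 0) ⊎-dec (separation b c ℕ.≤? d v w)

Covers : Labelled m q → Labelled m q → Set
Covers (b , u) (c , w) = b ≡ c × d u w ≡ 1

covers? : (g x : Labelled m q) → Dec (Covers g x)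
covers? (b , u) (c , w) = b Bool.≟ c ×-dec d u w ℕ.≟ 1

record Interlaced {ℓ} (D : Pred (Labelled m q) ℓ) : Set ℓ where
  field
    compatible : ∀ {x y} → x ∈ D → y ∈ D → Compatible x y
    covered    : ∀ {b v u} → (b , v) ∈ D → d v u ≡ 1 → ∃[ w ] ((not b , w) ∈ D × d u w ≡ 1)

demands : Labelled m q → List (Labelled m q)
demands (b , v) = map (not b ,_) (neighbours v)

-- xs are the labelled words placed so far and gs is a queue of pairs (b , u)
-- for which a neighbour of u with label b is still to be placed.
refutes : ℕ → List (Labelled m q) → List (Labelled m q) → Bool
-- `n` is fuel. Running out of it and reaching an empty queue both give `false`: nothing has been
-- refuted.
refutes zero    xs gs             = false
refutes (suc n) xs []             = false
refutes (suc n) xs ((b , u) ∷ gs) =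
  if does (any? (covers? (b , u)) xs)
  then refutes n xs gs
  -- Each compatible choice opens a branch; if there is none, `all` is `true` and the branch is
  -- contradictory.
  else all (λ w → refutes n ((b , w) ∷ xs) (gs ++ demands (b , w)))
           (filter (λ w → all? (compatible? (b , w)) xs) (neighbours u))

Refutable : Labelled m q → Set
Refutable x = ∃[ n ] refutes n [ x ] (demands x) ≡ true

module _ {ℓ} {D : Pred (Labelled m q) ℓ} (interlaced : Interlaced D) where
  open Interlaced interlaced

  Met : Pred (Labelled m q) ℓ
  Met (b , u) = ∃[ w ] ((b , w) ∈ D × d u w ≡ 1)

  demands-met : ∀ {x} → x ∈ D → All Met (demands x)
  demands-met {b , v} x∈D = All.map⁺ (All.tabulate λ u∈ →
    covered x∈D (proj₂ (∈-filter⁻ (λ w → d v w ℕ.≟ 1) {xs = words m q} u∈)))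

  -- `D` itself selects a branch at every choice: its word meeting the first demand is compatible
  -- with all of `xs`, so it is among the candidates.
  refutes-sound : ∀ n {xs gs} → All D xs → All Met gs → ¬ T (refutes n xs gs)
  refutes-sound (suc n) {xs} {(b , u) ∷ gs} ds ((w , w∈D , uw) ∷ ms) r
    with does (any? (covers? (b , u)) xs)
  ... | true  = refutes-sound n ds ms r
  ... | false = refutes-sound n (w∈D ∷ ds) (All.++⁺ ms (demands-met w∈D))
    (All.lookup (All.all⁺ _ _ r)
      (∈-filter⁺ (λ w → all? (compatible? (b , w)) xs)
        (∈-filter⁺ (λ w → d u w ℕ.≟ 1) (∈-words w) uw)
        (All.map (compatible w∈D) ds)))

  refutable⇒∉ : ∀ {x} → Refutable x → x ∉ D
  refutable⇒∉ (n , r) x∈D =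
    refutes-sound n (x∈D ∷ []) (demands-met x∈D) (Equivalence.from Bool.T-≡ r)

-- The origin, and isometries that move any word to it.

origin : Labelled 4 3
origin = true , replicate 4 zero

origin-refutable : Refutable origin
-- `refl` runs the search; 100 is enough fuel for every branch.
origin-refutable = 100 , refl

module _ (f f⁻¹ : Word m q → Word m q)
         (inverseˡ : ∀ v → f (f⁻¹ v) ≡ v) (isometric : ∀ v w → d (f v) (f w) ≡ d v w) where

  -- Both conditions speak only of labels and distances, which `map₂ f` preserves; `f⁻¹` supplies
  -- the covering word.
  pullback : ∀ {ℓ} {D : Pred (Labelled m q) ℓ} → Interlaced D → Interlaced (D ∘ map₂ f)
  pullback {D = D} interlaced = record
    { compatible = λ { {b , v} {c , w} x∈D y∈D →
        subst (λ n → (b ≡ c × n ≡ 0) ⊎ separation b c ≤ n) (isometric v w)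
              (compatible x∈D y∈D) }
    ; covered = λ {b} {v} {u} x∈D vu →
        let w , w∈D , uw = covered x∈D (trans (isometric v u) vu)
        in f⁻¹ w
         , subst (λ w → (not b , w) ∈ D) (sym (inverseˡ w)) w∈D
         , trans (sym (isometric u (f⁻¹ w))) (trans (cong (d (f u)) (inverseˡ w)) uw)
    }
    where open Interlaced interlaced

moveFromOrigin moveToOrigin : Word m (suc q) → Word m (suc q) → Word m (suc q)
moveFromOrigin = zipWith (transpose zero)
moveToOrigin   = zipWith (λ a → transpose a zero)

moveFromOrigin-inverse : ∀ (a v : Word m (suc q)) → moveFromOrigin a (moveToOrigin a v) ≡ v
moveFromOrigin-inverse []      []      = refl
moveFromOrigin-inverse (a ∷ as) (x ∷ v) =
  cong₂ _∷_ (transpose-inverse zero a) (moveFromOrigin-inverse as v)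

moveFromOrigin-zero : ∀ (a : Word m (suc q)) → moveFromOrigin a (replicate m zero) ≡ a
moveFromOrigin-zero []       = refl
moveFromOrigin-zero (a ∷ as) = cong (a ∷_) (moveFromOrigin-zero as)

transpose-injective : ∀ {n} (i j : Fin n) {k l} → transpose i j k ≡ transpose i j l → k ≡ l
transpose-injective i j p =
  trans (sym (transpose-inverse j i)) (trans (cong (transpose j i) p) (transpose-inverse j i))

moveFromOrigin-isometric : ∀ (a v w : Word m (suc q)) →
  d (moveFromOrigin a v) (moveFromOrigin a w) ≡ d v w
moveFromOrigin-isometric []       []      []      = refl
moveFromOrigin-isometric (a ∷ as) (x ∷ v) (y ∷ w)
  with transpose zero a x Fin.≟ transpose zero a y | x Fin.≟ y
... | yes _ | yes _   = moveFromOrigin-isometric as v w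
... | no _  | no _    = cong suc (moveFromOrigin-isometric as v w)
... | yes p | no x≢y  = contradiction (transpose-injective zero a p) x≢y
... | no p  | yes x≡y = contradiction (cong (transpose zero a) x≡y) p

-- If `(true , v)` were in `D`, the pullback along `moveFromOrigin v` would contain `origin`, which
-- the search excludes.
interlaced⇒true∉ : ∀ {ℓ} {D : Pred (Labelled 4 3) ℓ} → Interlaced D → ∀ v → (true , v) ∉ D
interlaced⇒true∉ {D = D} interlaced v v∈D =
  refutable⇒∉
    (pullback (moveFromOrigin v) (moveToOrigin v)
              (moveFromOrigin-inverse v) (moveFromOrigin-isometric v) interlaced)
    origin-refutable
    (subst (λ w → (true , w) ∈ D) (sym (moveFromOrigin-zero v)) v∈D)

-- Words in exactly one of two codes with the same neighbours.

Separated : ∀ {c} → Pred (Word m q) c → Set c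
Separated C = ∀ {v w} → v ∈ C → w ∈ C → v ≢ w → 3 ≤ d v w

module _ {c} (C : Bool → Pred (Word m q) c)
         (separated : ∀ b → Separated (C b))
         (Γ₁-⊆ : ∀ b → Γ₁ {H m q} (C b) ⊆ Γ₁ {H m q} (C (not b))) where

  Exclusive : Pred (Labelled m q) c
  Exclusive (b , v) = v ∈ C b × v ∉ C (not b)

  -- At distance 1, `w` would be a neighbour of `C b`, hence of `C (not b)`, and so lie outside
  -- `C (not b)`.
  opposite-2≤d : ∀ b {v w} → (b , v) ∈ Exclusive → w ∈ C (not b) → w ∉ C b → 2 ≤ d v w
  opposite-2≤d b {v} {w} (v∈ , v∉) w∈ w∉ with d v w in vw
  ... | 0           = contradiction (subst (_∈ C b) (d≡0⇒≡ v w vw) v∈) w∉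
  ... | 1           = contradiction w∈ (proj₁ (Γ₁-⊆ b (w∉ , v , v∈ , vw)))
  ... | suc (suc _) = s≤s (s≤s z≤n)

  exclusive-compatible : ∀ {x y} → x ∈ Exclusive → y ∈ Exclusive → Compatible x y
  exclusive-compatible {b , v} {c , w} x∈ y∈ with b Bool.≟ c
  ... | yes refl with ≡-dec Fin._≟_ v w
  ...   | yes refl = inj₁ (refl , d-refl v)
  ...   | no v≢w   = inj₂ (separated b (proj₁ x∈) (proj₁ y∈) v≢w)
  exclusive-compatible {b , v} {c , w} x∈ (w∈ , w∉) | no b≢c
    with refl ← Bool.¬-not (b≢c ∘ sym) =
    inj₂ (opposite-2≤d b x∈ w∈ (subst (λ e → w ∉ C e) (Bool.not-involutive b) w∉))

  exclusive-covered : ∀ {b v u} → (b , v) ∈ Exclusive → d v u ≡ 1 →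
                      ∃[ w ] ((not b , w) ∈ Exclusive × d u w ≡ 1)
  exclusive-covered {b} {v} {u} (v∈ , v∉) vu =
    let _ , w , w∈ , wu = Γ₁-⊆ b (u∉ , v , v∈ , vu)
        uw = trans (d-sym u w) wu
    in w , (w∈ , subst (λ e → w ∉ C e) (sym (Bool.not-involutive b)) (w∉ w∈ uw)) , uw
    where
    u∉ : u ∉ C b
    u∉ u∈ = ℕ.<⇒≱ (separated b v∈ u∈ v≢u) (ℕ.≤-trans (ℕ.≤-reflexive vu) (s≤s z≤n))
      where
      v≢u : v ≢ u
      v≢u refl = contradiction (trans (sym (d-refl v)) vu) λ ()
    w∉ : ∀ {w} → w ∈ C (not b) → d u w ≡ 1 → w ∉ C b
    w∉ {w} w∈ uw w∈b =
      -- `w` differs from `v`, which is outside `C (not b)`, so separation contradicts the path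
      -- through `u` of length 2.
      ℕ.<⇒≱ (separated b v∈ w∈b λ { refl → v∉ w∈ })
            (ℕ.≤-trans (d-triangle v u w) (ℕ.≤-reflexive (cong₂ _+_ vu uw)))

  exclusive-interlaced : Interlaced Exclusive
  exclusive-interlaced = record
    { compatible = exclusive-compatible ; covered = exclusive-covered }

-- Images of codes under automorphisms.

module _ (g : Automorphism (H m q)) where
  open Automorphism g

  to-injective : ∀ {v w} → to v ≡ to w → v ≡ w
  to-injective {v} {w} p =
    trans (sym (strictlyInverseʳ v)) (trans (cong from p) (strictlyInverseʳ w))

  -- Only adjacency is preserved by assumption, so short distances are split
  -- into paths of length at most two.
  d-to≤2⇒d≤2 : ∀ {v w} → d (to v) (to w) ≤ 2 → d v w ≤ 2
  d-to≤2⇒d≤2 {v} {w} le with d (to v) (to w) in eq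
  ... | 0 = subst (λ u → d v u ≤ 2) (to-injective (d≡0⇒≡ _ _ eq))
              (ℕ.≤-trans (ℕ.≤-reflexive (d-refl v)) z≤n)
  ... | 1 = ℕ.≤-trans (ℕ.≤-reflexive (Equivalence.from (preserves v w) eq)) (s≤s z≤n)
  ... | 2 = let u , vu , uw = d≡suc⇒step (to v) (to w) eq
                u≡ = strictlyInverseˡ u
            in ℕ.≤-trans (d-triangle v (from u) w) (ℕ.≤-reflexive (cong₂ _+_
                 (Equivalence.from (preserves v (from u)) (trans (cong (d (to v)) u≡) vu))
                 (Equivalence.from (preserves (from u) w)
                   (trans (cong (λ x → d x (to w)) u≡) uw))))
  ... | suc (suc (suc _)) = contradiction le λ { (s≤s (s≤s ())) }

  image-separated : ∀ {c} {C : Pred (Word m q) c} → Separated C → Separated (image g C)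
  image-separated separated (v , v∈ , refl) (w , w∈ , refl) gv≢gw =
    ℕ.≰⇒> (ℕ.<⇒≱ (separated v∈ w∈ (gv≢gw ∘ cong to)) ∘ d-to≤2⇒d≤2)

  -- With the converse below: taking neighbours commutes with `g`, so a code and its image share
  -- their neighbours once `g` fixes the neighbour set.
  image-Γ₁⊆Γ₁-image : ∀ {c} {C : Pred (Word m q) c} →
    image g (Γ₁ {H m q} C) ⊆ Γ₁ {H m q} (image g C)
  image-Γ₁⊆Γ₁-image {C = C} (u , (u∉ , v , v∈ , vu) , refl) =
    (λ (w , w∈ , p) → u∉ (subst (_∈ C) (to-injective p) w∈)) ,
    to v , (v , v∈ , refl) , Equivalence.to (preserves v u) vu

  Γ₁-image⊆image-Γ₁ : ∀ {c} {C : Pred (Word m q) c} →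
    Γ₁ {H m q} (image g C) ⊆ image g (Γ₁ {H m q} C)
  Γ₁-image⊆image-Γ₁ {x = u} (u∉ , _ , (v , v∈ , refl) , vu) =
    from u ,
    ((λ w∈ → u∉ (from u , w∈ , strictlyInverseˡ u)) , v , v∈ ,
      Equivalence.from (preserves v (from u)) (trans (cong (d (to v)) (strictlyInverseˡ u)) vu)) ,
    strictlyInverseˡ u

lemma3p13 : ∀ {c x} →
    ¬ ∃₂ λ (C : Code 4 3 c) (X : Subgroup (Aut (H 4 3)) x) → ElusivePair 4 3 3 C X
lemma3p13 {c} (C , X , elusive) =
  -- Membership in `C` need not be decidable, but the goal is a negation, so it may be decided at
  -- each of the finitely many words.
  All.sequenceM c ¬¬-Monad (All.universal (λ _ → ¬¬-excluded-middle) (words 4 3)) λ C? →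
    does-not-fix-code λ g g∈X →
      image⊆ C? g g∈X ,
      -- The reverse inclusion is the same inclusion for the inverse of `g`.
      λ {v} v∈ → Automorphism.from g v
               , image⊆ C? (Group._⁻¹ (Aut (H 4 3)) g) (⁻¹-closed g∈X) (v , v∈ , refl)
               , Automorphism.strictlyInverseˡ g v
  where
  open ElusivePair elusive
  open MinimumDistance minimumDistance
  open Subgroup X

  image⊆ : All (Dec ∘ C) (words 4 3) → ∀ g → g ∈ Member → image g C ⊆ C
  image⊆ C? g g∈X {v} v∈gC with All.lookup C? (∈-words v)
  ... | yes v∈C = v∈C
  ... | no v∉C  = contradiction (v∈gC , v∉C)
    (interlaced⇒true∉ (exclusive-interlaced codes separated Γ₁-⊆) v)
    where
    -- `true` marks the image code, so a word of the image outside `C` is an exclusive word labelled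
    -- `true`.
    codes : Bool → Code 4 3 c
    codes true  = image g C
    codes false = C

    separated : ∀ b → Separated (codes b)
    separated true  = image-separated g lowerBound
    separated false = lowerBound

    Γ₁-⊆ : ∀ b → Γ₁ {H 4 3} (codes b) ⊆ Γ₁ {H 4 3} (codes (not b))
    Γ₁-⊆ true  = proj₁ (fixes-neighbours g g∈X) ∘ Γ₁-image⊆image-Γ₁ g
    Γ₁-⊆ false = image-Γ₁⊆Γ₁-image g ∘ proj₂ (fixes-neighbours g g∈X)
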